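{- Let $G_1$ and $G_2$ be two disjoint connected graphs and let $x_i,y_i\in V(G_i)$ for $i\in\{1,2\}$. Let $C(G_1,G_2)$ be the chain of the graphs $G_1,G_2$ with respect to the vertices $x_1,y_1,x_2,y_2$, i.e. the graph obtained from the disjoint union of $G_1$ and $G_2$ by identifying the vertex $y_1$ with the vertex $x_2$. Then $$\gamma_{sp}(G_1)+\gamma_{sp}(G_2)-1\leq \gamma_{sp}(C(G_1,G_2))\leq \gamma_{sp}(G_1)+\gamma_{sp}(G_2).$$
   Context: All graphs are finite, simple and undirected. $N(v)$ denotes the open neighbourhood of $v$. For a graph $G=(V,E)$ and $S\subseteq V$ write $\overline{S}=V\setminus S$. A set $S\subseteq V$ is dominating if every vertex of $\overline{S}$ is adjacent to at least one vertex of $S$. A dominating set $S$ is a super dominating set of $G$ if for every $u\in\overline{S}$ there exists $w\in S$ with $N(w)\cap\overline{S}=\{u\}$. The super domination number $\gamma_{sp}(G)$ is the minimum cardinality of a super dominating set of $G$. -}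

module Defs where

open import Data.Bool.Properties as Bool using ()
open import Data.Fin.Base using (Fin; _↑ˡ_; _↑ʳ_; join; splitAt; punchIn; punchOut)
open import Data.Fin.Properties using (_≟_; any?; all?; ↑ˡ-injective; ↑ʳ-injective; splitAt-↑ˡ; splitAt-↑ʳ; join-splitAt; punchOut-injective; punchOut-punchIn; punchOut-cong; punchInᵢ≢i)
open import Data.Fin.Subset using (Subset; _∈_; ∁; _∩_; ⁅_⁆; ∣_∣; ⊤)
open import Data.Fin.Subset.Properties using (_∈?_; ∈⊤; x∈p⇒x∉∁p; anySubset?)
open import Data.Nat.Base using (ℕ; suc; pred; _+_; _≤_; _<_)
open import Data.Nat.Induction using (<-wellFounded)
open import Data.Nat.Properties using (_<?_; ≮⇒≥)
open import Data.Product.Base using (∃; ∃₂; _×_; _,_; proj₁)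
open import Data.Sum.Base using (_⊎_; inj₁; inj₂)
open import Data.Sum.Relation.Binary.Pointwise using (Pointwise; inj₁; inj₂; ⊎-symmetric; ⊎-decidable)
open import Data.Vec.Base using (tabulate)
open import Data.Vec.Properties using (≡-dec)
open import Induction.WellFounded using (Acc; acc)
open import Level using (0ℓ)
open import Relation.Binary.Construct.Closure.ReflexiveTransitive using (Star)
open import Relation.Binary.Core using (Rel)
open import Relation.Binary.Definitions using (Decidable; Irreflexive; Symmetric)
open import Relation.Binary.PropositionalEquality using (_≡_; _≢_; refl; sym; trans; cong)
open import Relation.Nullary using (Dec; yes; no; does; contradiction)
open import Relation.Nullary.Decidable using (map′; _×-dec_; _⊎-dec_; _→-dec_)
import Relation.Unary as Unary

private
  variable
    n n₁ n₂ : ℕ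

-- The vertex set is Fin n; n = 0 is allowed.
record Graph (n : ℕ) : Set₁ where
  field
    Adj        : Rel (Fin n) 0ℓ
    Adj?       : Decidable Adj
    Adj-sym    : Symmetric Adj
    Adj-irrefl : Irreflexive _≡_ Adj

  N : Fin n → Subset n
  N v = tabulate (λ u → does (Adj? v u))

open Graph

Connected : Graph n → Set
Connected G = ∀ u v → Star (Adj G) u v

Dominating : Graph n → Subset n → Set
Dominating G S = ∀ u → u ∈ ∁ S → ∃ λ w → w ∈ S × Adj G u w

SuperDominating : Graph n → Subset n → Set
SuperDominating G S =
  Dominating G S ×
  (∀ u → u ∈ ∁ S → ∃ λ w → w ∈ S × N G w ∩ ∁ S ≡ ⁅ u ⁆)

superDominating? : (G : Graph n) → Unary.Decidable (SuperDominating G)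
superDominating? G S =
  all? (λ u → (u ∈? ∁ S) →-dec any? (λ w → (w ∈? S) ×-dec Adj? G u w))
  ×-dec
  all? (λ u → (u ∈? ∁ S) →-dec
    any? (λ w → (w ∈? S) ×-dec ≡-dec Bool._≟_ (N G w ∩ ∁ S) ⁅ u ⁆))

⊤-superDominating : (G : Graph n) → SuperDominating G ⊤
⊤-superDominating G =
  (λ u u∈∁⊤ → contradiction u∈∁⊤ (x∈p⇒x∉∁p ∈⊤)) ,
  (λ u u∈∁⊤ → contradiction u∈∁⊤ (x∈p⇒x∉∁p ∈⊤))

MinimumSuperDominating : Graph n → Subset n → Set
MinimumSuperDominating G S =
  SuperDominating G S × (∀ T → SuperDominating G T → ∣ S ∣ ≤ ∣ T ∣)

minimumSuperDominating : (G : Graph n) → ∃ (MinimumSuperDominating G)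
minimumSuperDominating G =
  descend ⊤ (⊤-superDominating G) (<-wellFounded _)
  where
  descend : ∀ S → SuperDominating G S → Acc _<_ ∣ S ∣ →
            ∃ (MinimumSuperDominating G)
  descend S sd (acc rec)
    with anySubset? (λ T → superDominating? G T ×-dec (∣ T ∣ <? ∣ S ∣))
  ... | yes (T , sdT , T<S) = descend T sdT (rec T<S)
  ... | no ∄smaller = S , sd , λ T sdT → ≮⇒≥ λ T<S → ∄smaller (T , sdT , T<S)

γsp : Graph n → ℕ
γsp G = ∣ proj₁ (minimumSuperDominating G) ∣

-- The quotient map from V(G₁) ⊎ V(G₂) that identifies y₁ with x₂.  The
-- vertices of G₁ come first, then those of G₂ other than x₂; pred n₂ avoids
-- requiring n₂ to be a successor (it is one, because x₂ exists).
glue : Fin n₁ → Fin n₂ → Fin n₁ ⊎ Fin n₂ → Fin (n₁ + pred n₂)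
glue {n₂ = n₂} y₁ x₂ (inj₁ i) = i ↑ˡ pred n₂
glue {n₁} {suc m₂} y₁ x₂ (inj₂ j) with x₂ ≟ j
... | yes _    = y₁ ↑ˡ m₂
... | no  x₂≢j = n₁ ↑ʳ punchOut x₂≢j

private
  ↑ˡ≢↑ʳ : ∀ {m n} (i : Fin m) (j : Fin n) → i ↑ˡ n ≢ m ↑ʳ j
  ↑ˡ≢↑ʳ {m} {n} i j eq
    with () ← trans (sym (splitAt-↑ˡ m i n))
                    (trans (cong (splitAt m) eq) (splitAt-↑ʳ m n j))

glue-injective₁ : (y₁ : Fin n₁) (x₂ : Fin n₂) → ∀ {i i′} →
                  glue y₁ x₂ (inj₁ i) ≡ glue y₁ x₂ (inj₁ i′) → i ≡ i′
glue-injective₁ {n₂ = n₂} y₁ x₂ = ↑ˡ-injective (pred n₂) _ _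

glue-injective₂ : (y₁ : Fin n₁) (x₂ : Fin n₂) → ∀ {j j′} →
                  glue y₁ x₂ (inj₂ j) ≡ glue y₁ x₂ (inj₂ j′) → j ≡ j′
glue-injective₂ {n₁} {suc m₂} y₁ x₂ {j} {j′} eq with x₂ ≟ j | x₂ ≟ j′
... | yes x₂≡j | yes x₂≡j′ = trans (sym x₂≡j) x₂≡j′
... | yes _    | no _      = contradiction eq (↑ˡ≢↑ʳ _ _)
... | no _     | yes _     = contradiction (sym eq) (↑ˡ≢↑ʳ _ _)
... | no x₂≢j  | no x₂≢j′  =
  punchOut-injective x₂≢j x₂≢j′ (↑ʳ-injective n₁ _ _ eq)

glue-identifies : (y₁ : Fin n₁) (x₂ : Fin n₂) →
                  glue y₁ x₂ (inj₁ y₁) ≡ glue y₁ x₂ (inj₂ x₂)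
glue-identifies {n₂ = suc _} y₁ x₂ with x₂ ≟ x₂
... | yes _    = refl
... | no x₂≢x₂ = contradiction refl x₂≢x₂

glue-identifies-only : (y₁ : Fin n₁) (x₂ : Fin n₂) → ∀ {i j} →
                       glue y₁ x₂ (inj₁ i) ≡ glue y₁ x₂ (inj₂ j) →
                       i ≡ y₁ × j ≡ x₂
glue-identifies-only {n₂ = suc m₂} y₁ x₂ {j = j} eq with x₂ ≟ j
... | yes x₂≡j = ↑ˡ-injective m₂ _ _ eq , sym x₂≡j
... | no _     = contradiction eq (↑ˡ≢↑ʳ _ _)

glue-surjective : (y₁ : Fin n₁) (x₂ : Fin n₂) →
                  ∀ v → ∃ λ a → glue y₁ x₂ a ≡ v
glue-surjective {n₁} {suc m₂} y₁ x₂ v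
  with splitAt n₁ v | join-splitAt n₁ m₂ v
... | inj₁ i | eq = inj₁ i , eq
... | inj₂ k | eq = inj₂ (punchIn x₂ k) , trans glue-punchIn eq
  where
  glue-punchIn : glue y₁ x₂ (inj₂ (punchIn x₂ k)) ≡ n₁ ↑ʳ k
  glue-punchIn with x₂ ≟ punchIn x₂ k
  ... | yes x₂≡ = contradiction (sym x₂≡) (punchInᵢ≢i x₂ k)
  ... | no  x₂≢ =
    cong (n₁ ↑ʳ_) (trans (punchOut-cong x₂ refl) (punchOut-punchIn x₂))

-- Two vertices of the chain are adjacent when they are the classes of vertices
-- adjacent in the disjoint union of G₁ and G₂, whose adjacency relation is the
-- Pointwise sum.
ChainAdj : Graph n₁ → Graph n₂ → Fin n₁ → Fin n₂ → Rel (Fin (n₁ + pred n₂)) 0ℓ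
ChainAdj G₁ G₂ y₁ x₂ u v =
  ∃₂ λ a b → Pointwise (Adj G₁) (Adj G₂) a b × glue y₁ x₂ a ≡ u × glue y₁ x₂ b ≡ v

private
  any⊎? : ∀ {m n} {P : Fin m ⊎ Fin n → Set} → Unary.Decidable P → Dec (∃ P)
  any⊎? {P = P} P? = map′ to from
    (any? (λ i → P? (inj₁ i)) ⊎-dec any? (λ j → P? (inj₂ j)))
    where
    to : ∃ (λ i → P (inj₁ i)) ⊎ ∃ (λ j → P (inj₂ j)) → ∃ P
    to (inj₁ (i , p)) = inj₁ i , p
    to (inj₂ (j , p)) = inj₂ j , p
    from : ∃ P → ∃ (λ i → P (inj₁ i)) ⊎ ∃ (λ j → P (inj₂ j))
    from (inj₁ i , p) = inj₁ (i , p)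
    from (inj₂ j , p) = inj₂ (j , p)

-- Of the four attaching vertices only y₁ and x₂ affect a chain of two graphs:
-- x₁ and y₂ are the free ends.
chain : (G₁ : Graph n₁) (G₂ : Graph n₂) (x₁ y₁ : Fin n₁) (x₂ y₂ : Fin n₂) →
        Graph (n₁ + pred n₂)
chain G₁ G₂ _ y₁ x₂ _ = record
  { Adj        = ChainAdj G₁ G₂ y₁ x₂
  ; Adj?       = λ u v → any⊎? λ a → any⊎? λ b →
      ⊎-decidable (Adj? G₁) (Adj? G₂) a b
        ×-dec (glue y₁ x₂ a ≟ u) ×-dec (glue y₁ x₂ b ≟ v)
  ; Adj-sym    = λ (a , b , a~b , a≡u , b≡v) →
      b , a , ⊎-symmetric (Adj-sym G₁) (Adj-sym G₂) a~b , b≡v , a≡u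
  ; Adj-irrefl = λ u≡v (_ , _ , a~b , a≡u , b≡v) →
      irrefl a~b (trans a≡u (trans u≡v (sym b≡v)))
  }
  where
  irrefl : ∀ {a b} → Pointwise (Adj G₁) (Adj G₂) a b →
           glue y₁ x₂ a ≢ glue y₁ x₂ b
  irrefl (inj₁ i~i′) eq = Adj-irrefl G₁ (glue-injective₁ y₁ x₂ eq) i~i′
  irrefl (inj₂ j~j′) eq = Adj-irrefl G₂ (glue-injective₂ y₁ x₂ eq) j~j′

{-# OPTIONS --safe #-}

-- Work with the complement D of a super dominating set: every u ∈ D has a
-- private neighbour w ∉ D, one with N(w) ∩ D = {u}.  For such a D of maximum
-- size, γsp + |D| is the number of vertices.
--
-- Lower bound: given such a D in the chain, put a vertex of D into Dᵢ when one
-- of its private neighbours is adjacent to it inside Gᵢ.  Then D₁ and D₂ have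
-- private neighbours within G₁ and G₂, and together they cover D.
--
-- Upper bound: replacing D by a set of private neighbours, one for each vertex,
-- exchanges the two roles, so each Dᵢ can be assumed to avoid the identified
-- vertex v.  The union D₁ ∪ D₂ then fails only if v is the private neighbour of
-- some u in one part while having neighbours in the other, and this is mended by
-- deleting one such u.
module Submission where

open import Defs
open import Algebra.Properties.CommutativeSemigroup using (interchange)
open import Data.Fin using (Fin)
open import Data.Fin.Base using (zero; suc)
open import Data.Fin.Properties using (_≟_; any?; all?; 0≢1+n; suc-injective)
open import Data.Fin.Subset
  using (Subset; inside; outside; _∈_; _∉_; _⊆_; ∁; _∩_; _∪_; _-_; ⁅_⁆; ∣_∣; Empty)
open import Data.Fin.Subset.Properties
open import Data.Nat using (ℕ; _+_; _∸_; _≤_)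
open import Data.Nat.Base using (suc; z≤n; s≤s)
open import Data.Nat.Properties hiding (_≟_; 0≢1+n; suc-injective)
open import Data.Product using (_×_)
open import Data.Product.Base using (∃; ∃₂; _,_; proj₁; proj₂)
open import Data.Sum.Base as Sum using (_⊎_; inj₁; inj₂)
open import Data.Sum.Relation.Binary.Pointwise using (inj₁; inj₂)
open import Data.Vec.Base using ([]; _∷_; here; there; tabulate)
open import Data.Vec.Properties using (lookup⇒[]=; []=⇒lookup; lookup∘tabulate)
open import Function.Base using (_∘_)
open import Relation.Binary.PropositionalEquality
  using (_≡_; _≢_; refl; sym; trans; cong; cong₂; subst; subst₂)
open import Relation.Nullary using (Dec; yes; no; does; ¬_; contradiction)
open import Relation.Nullary.Decidable using (_×-dec_; _→-dec_; ¬?; map′; dec-true)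
import Relation.Unary as Unary

open Graph

private
  variable
    k m n : ℕ

-- Finite subsets: comprehension, cardinalities and images.

module _ {P : Fin n → Set} (P? : Unary.Decidable P) where

  ∈-tabulate⁺ : ∀ {x} → P x → x ∈ tabulate (does ∘ P?)
  ∈-tabulate⁺ {x} px =
    lookup⇒[]= x _ (trans (lookup∘tabulate (does ∘ P?) x) (dec-true (P? x) px))

  ∈-tabulate⁻ : ∀ {x} → x ∈ tabulate (does ∘ P?) → P x
  ∈-tabulate⁻ {x} x∈ with P? x | trans (sym (lookup∘tabulate (does ∘ P?) x)) ([]=⇒lookup x∈)
  ... | yes px | _ = px

-- A relation stands in for an injection because the witness `y` may depend on the proof of `x ∈ p`.
-- The induction removes from `q` the partner of the first element, which injectivity of `R` keeps
-- from being reused.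
∣∣-mono-injective : (R : Fin m → Fin n → Set) →
                    (∀ {x x′ y} → R x y → R x′ y → x ≡ x′) →
                    (p : Subset m) (q : Subset n) →
                    (∀ {x} → x ∈ p → ∃ λ y → y ∈ q × R x y) → ∣ p ∣ ≤ ∣ q ∣
∣∣-mono-injective R inj []            q f = z≤n
∣∣-mono-injective R inj (outside ∷ p) q f =
  ∣∣-mono-injective (R ∘ suc) (λ r r′ → suc-injective (inj r r′)) p q (f ∘ there)
∣∣-mono-injective R inj (inside ∷ p)  q f with f here
... | y₀ , y₀∈q , r₀ = ≤-trans
  (s≤s (∣∣-mono-injective (R ∘ suc) (λ r r′ → suc-injective (inj r r′)) p (q - y₀) f′))
  (x∈p⇒∣p-x∣<∣p∣ y₀∈q)
  where
  f′ : ∀ {x} → x ∈ p → ∃ λ y → y ∈ q - y₀ × R (suc x) y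
  f′ x∈p with f (there x∈p)
  ... | y , y∈q , r =
    y , x∈p∧x≢y⇒x∈p-y y∈q (λ { refl → 0≢1+n (inj r₀ r) }) , r

∣p∪q∣+∣p∩q∣≡∣p∣+∣q∣ : (p q : Subset n) → ∣ p ∪ q ∣ + ∣ p ∩ q ∣ ≡ ∣ p ∣ + ∣ q ∣
∣p∪q∣+∣p∩q∣≡∣p∣+∣q∣ []            []            = refl
∣p∪q∣+∣p∩q∣≡∣p∣+∣q∣ (outside ∷ p) (outside ∷ q) = ∣p∪q∣+∣p∩q∣≡∣p∣+∣q∣ p q
∣p∪q∣+∣p∩q∣≡∣p∣+∣q∣ (inside  ∷ p) (outside ∷ q) = cong suc (∣p∪q∣+∣p∩q∣≡∣p∣+∣q∣ p q)
∣p∪q∣+∣p∩q∣≡∣p∣+∣q∣ (outside ∷ p) (inside  ∷ q) =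
  trans (cong suc (∣p∪q∣+∣p∩q∣≡∣p∣+∣q∣ p q)) (sym (+-suc _ _))
∣p∪q∣+∣p∩q∣≡∣p∣+∣q∣ (inside  ∷ p) (inside  ∷ q) =
  cong suc (trans (+-suc _ _) (trans (cong suc (∣p∪q∣+∣p∩q∣≡∣p∣+∣q∣ p q)) (sym (+-suc _ _))))

∣p∪q∣≤∣p∣+∣q∣ : (p q : Subset n) → ∣ p ∪ q ∣ ≤ ∣ p ∣ + ∣ q ∣
∣p∪q∣≤∣p∣+∣q∣ p q = ≤-trans (m≤m+n _ _) (≤-reflexive (∣p∪q∣+∣p∩q∣≡∣p∣+∣q∣ p q))

disjoint⇒∣p∣+∣q∣≤∣p∪q∣ : (p q : Subset n) → Empty (p ∩ q) → ∣ p ∣ + ∣ q ∣ ≤ ∣ p ∪ q ∣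
disjoint⇒∣p∣+∣q∣≤∣p∪q∣ {n} p q empty = ≤-reflexive
  (trans (sym (∣p∪q∣+∣p∩q∣≡∣p∣+∣q∣ p q))
  (trans (cong (∣ p ∪ q ∣ +_) (trans (cong ∣_∣ (Empty-unique empty)) (∣⊥∣≡0 n)))
         (+-identityʳ _)))

y∉p-y : (p : Subset n) {y : Fin n} → y ∉ p - y
y∉p-y (_ ∷ p) {zero}  ()
y∉p-y (_ ∷ p) {suc y} (there y∈) = y∉p-y p y∈

image? : (f : Fin m → Fin n) (p : Subset m) →
         Unary.Decidable (λ y → ∃ λ x → x ∈ p × f x ≡ y)
image? f p y = any? λ x → (x ∈? p) ×-dec (f x ≟ y)

image : (Fin m → Fin n) → Subset m → Subset n
image f p = tabulate (does ∘ image? f p)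

∈-image⁺ : (f : Fin m → Fin n) (p : Subset m) → ∀ {x} → x ∈ p → f x ∈ image f p
∈-image⁺ f p x∈p = ∈-tabulate⁺ (image? f p) (_ , x∈p , refl)

∈-image⁻ : (f : Fin m → Fin n) (p : Subset m) →
           ∀ {y} → y ∈ image f p → ∃ λ x → x ∈ p × f x ≡ y
∈-image⁻ f p = ∈-tabulate⁻ (image? f p)

∣image∣≤ : (f : Fin m → Fin n) (p : Subset m) → ∣ image f p ∣ ≤ ∣ p ∣
∣image∣≤ f p = ∣∣-mono-injective (λ y x → f x ≡ y) (λ eq eq′ → trans (sym eq) eq′)
                 (image f p) p (∈-image⁻ f p)

∣image∣≥ : (f : Fin m → Fin n) → (∀ {x x′} → f x ≡ f x′ → x ≡ x′) →
           (p : Subset m) → ∣ p ∣ ≤ ∣ image f p ∣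
∣image∣≥ f inj p = ∣∣-mono-injective (λ x y → f x ≡ y)
  (λ eq eq′ → inj (trans eq (sym eq′))) p (image f p)
  (λ x∈p → _ , ∈-image⁺ f p x∈p , refl)

-- Private neighbours and complements of super dominating sets.

record Private (G : Graph n) (D : Subset n) (w u : Fin n) : Set where
  constructor mkPrivate
  field
    member   : u ∈ D
    outer    : w ∉ D
    adjacent : Adj G w u
    unique   : ∀ u′ → u′ ∈ D → Adj G w u′ → u′ ≡ u

open Private

private? : (G : Graph n) (D : Subset n) → ∀ w u → Dec (Private G D w u)
private? G D w u = map′
  (λ (a , b , c , d) → mkPrivate a b c d)
  (λ (mkPrivate a b c d) → a , b , c , d)
  ((u ∈? D) ×-dec ¬? (w ∈? D) ×-dec Adj? G w u ×-dec
   all? (λ u′ → (u′ ∈? D) →-dec Adj? G w u′ →-dec (u′ ≟ u)))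

PrivatelyMatched : Graph n → Subset n → Set
PrivatelyMatched G D = ∀ {u} → u ∈ D → ∃ λ w → Private G D w u

Private-antitone : (G : Graph n) {D D′ : Subset n} → D′ ⊆ D →
                   ∀ {w u} → u ∈ D′ → Private G D w u → Private G D′ w u
Private-antitone G D′⊆D u∈D′ π = mkPrivate u∈D′ (outer π ∘ D′⊆D) (adjacent π)
  (λ u′ u′∈D′ → unique π u′ (D′⊆D u′∈D′))

superDominating⇒matched : (G : Graph n) {S : Subset n} →
                          SuperDominating G S → PrivatelyMatched G (∁ S)
superDominating⇒matched G {S} (_ , priv) {u} u∈∁S with priv u u∈∁S
... | w , w∈S , eq = w , mkPrivate u∈∁S (x∈p⇒x∉∁p w∈S)
  (∈-tabulate⁻ (Adj? G w)
    (proj₁ (x∈p∩q⁻ (N G w) (∁ S) (subst (u ∈_) (sym eq) (x∈⁅x⁆ u)))))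
  (λ u′ u′∈∁S w~u′ → x∈⁅y⁆⇒x≡y u
    (subst (u′ ∈_) eq (x∈p∩q⁺ (∈-tabulate⁺ (Adj? G w) w~u′ , u′∈∁S))))

-- A private neighbour of `u` lies in `∁ D` and is adjacent to `u`, so one witness serves both
-- clauses.
matched⇒superDominating : (G : Graph n) {D : Subset n} →
                          PrivatelyMatched G D → SuperDominating G (∁ D)
matched⇒superDominating G {D} matched =
  (λ u u∈ → let w , π = matched (∁∁⁻ u∈) in
     w , x∉p⇒x∈∁p (outer π) , Adj-sym G (adjacent π)) ,
  (λ u u∈ → let w , π = matched (∁∁⁻ u∈) in
     w , x∉p⇒x∈∁p (outer π) , ⊆-antisym (only π) (occurs u∈ π))
  where
  ∁∁⁻ : ∁ (∁ D) ⊆ D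
  ∁∁⁻ x∈ = x∉∁p⇒x∈p (x∈∁p⇒x∉p x∈)

  only : ∀ {w u} → Private G D w u → N G w ∩ ∁ (∁ D) ⊆ ⁅ u ⁆
  only {w} {u} π {x} x∈ with x∈p∩q⁻ (N G w) (∁ (∁ D)) x∈
  ... | x∈N , x∈∁∁ with refl ← unique π x (∁∁⁻ x∈∁∁) (∈-tabulate⁻ (Adj? G w) x∈N) = x∈⁅x⁆ u

  occurs : ∀ {w u} → u ∈ ∁ (∁ D) → Private G D w u → ⁅ u ⁆ ⊆ N G w ∩ ∁ (∁ D)
  occurs {w} {u} u∈ π x∈ with refl ← x∈⁅y⁆⇒x≡y u x∈ =
    x∈p∩q⁺ (∈-tabulate⁺ (Adj? G w) (adjacent π) , u∈)

-- Minimality of `γsp` is tested against `∁ D`. Equality is attained by `maximumMatched`, so bounds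
-- on `γsp` become comparisons of matched sets.
γsp+∣matched∣≤n : (G : Graph n) {D : Subset n} → PrivatelyMatched G D → γsp G + ∣ D ∣ ≤ n
γsp+∣matched∣≤n {n} G {D} matched = begin
  γsp G + ∣ D ∣     ≤⟨ +-monoˡ-≤ ∣ D ∣ (proj₂ (proj₂ (minimumSuperDominating G)) (∁ D)
                         (matched⇒superDominating G matched)) ⟩
  ∣ ∁ D ∣ + ∣ D ∣   ≡⟨ cong (_+ ∣ D ∣) (∣∁p∣≡n∸∣p∣ D) ⟩
  n ∸ ∣ D ∣ + ∣ D ∣ ≡⟨ m∸n+n≡m (∣p∣≤n D) ⟩
  n                 ∎
  where open ≤-Reasoning

maximumMatched : (G : Graph n) → ∃ λ D → PrivatelyMatched G D × γsp G + ∣ D ∣ ≡ n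
maximumMatched G with minimumSuperDominating G
... | S , sd , _ = ∁ S , superDominating⇒matched G sd ,
  trans (cong (∣ S ∣ +_) (∣∁p∣≡n∸∣p∣ S)) (m+[n∸m]≡n (∣p∣≤n S))

-- Adjusting a matched set at a prescribed vertex.

chooseOn : (p : Subset n) {Q : Fin n → Fin n → Set} → (∀ {u} → u ∈ p → ∃ (Q u)) →
           ∃ λ (f : Fin n → Fin n) → ∀ {u} → u ∈ p → Q u (f u)
chooseOn p {Q} h = (proj₁ ∘ pick) , (λ {u} → proj₂ (pick u))
  where
  pick : ∀ u → ∃ λ w → u ∈ p → Q u w
  pick u with u ∈? p
  ... | yes u∈p = proj₁ (h u∈p) , λ _ → proj₂ (h u∈p)
  -- An arbitrary default: it makes the choice total, so that `image` applies to it.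
  ... | no  u∉p = u , λ u∈p → contradiction u∈p u∉p

-- If `y` is in `D`, the chosen private neighbours all lie outside `D` and so avoid `y`. They are as
-- many as `D`, since a vertex cannot be private to two members of `D`.
matchedAvoiding : (G : Graph n) (y : Fin n) (D : Subset n) → PrivatelyMatched G D →
                  ∃ λ D′ → PrivatelyMatched G D′ × y ∉ D′ × ∣ D ∣ ≤ ∣ D′ ∣
matchedAvoiding G y D matched with y ∈? D
... | no  y∉D = D , matched , y∉D , ≤-refl
... | yes y∈D with chooseOn D matched
... | f , π = image f D , matched′ , (λ y∈ → ∉D y∈ y∈D) ,
  ∣∣-mono-injective (λ u w → Private G D w u)
    (λ {_} {u′} ρ ρ′ → sym (unique ρ u′ (member ρ′) (adjacent ρ′)))
    D (image f D) (λ u∈D → _ , ∈-image⁺ f D u∈D , π u∈D)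
  where
  ∉D : ∀ {w} → w ∈ image f D → w ∉ D
  ∉D w∈ with u , u∈D , refl ← ∈-image⁻ f D w∈ = outer (π u∈D)

  matched′ : PrivatelyMatched G (image f D)
  matched′ w∈ with u , u∈D , refl ← ∈-image⁻ f D w∈ =
    u , mkPrivate w∈ (λ u∈ → ∉D u∈ u∈D) (Adj-sym G (adjacent (π u∈D))) uniq
    where
    uniq : ∀ w′ → w′ ∈ image f D → Adj G u w′ → w′ ≡ f u
    uniq w′ w′∈ u~w′ with u′ , u′∈D , refl ← ∈-image⁻ f D w′∈ =
      -- `u` is a member of `D` adjacent to `f u′`, whose only neighbour in `D` is `u′`.
      cong f (sym (unique (π u′∈D) u u∈D (Adj-sym G u~w′)))

NoNeighbourIn : Graph n → Subset n → Fin n → Set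
NoNeighbourIn G D y = ∀ u → u ∈ D → ¬ Adj G y u

-- If `y` is a private neighbour of `u`, then `u` is its only neighbour in `D`, so deleting `u`
-- leaves `y` with none.
isolateOrUnused : (G : Graph n) (y : Fin n) (D : Subset n) → PrivatelyMatched G D → y ∉ D →
  (∃ λ D′ → PrivatelyMatched G D′ × y ∉ D′ × NoNeighbourIn G D′ y × ∣ D ∣ ≤ suc ∣ D′ ∣) ⊎
  (∀ w u → Private G D w u → w ≢ y)
isolateOrUnused G y D matched y∉D with any? (private? G D y)
... | no  unused  = inj₂ λ { w u π refl → unused (u , π) }
... | yes (u , π) = inj₁
  ( D - u
  , (λ x∈ → let w , ρ = matched (D-u⊆D x∈) in w , Private-antitone G D-u⊆D x∈ ρ)
  , y∉D ∘ D-u⊆D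
  , (λ x x∈ y~x → y∉p-y D (subst (_∈ D - u) (unique π x (D-u⊆D x∈) y~x) x∈))
  , size )
  where
  D-u⊆D : D - u ⊆ D
  D-u⊆D = p─q⊆p D ⁅ u ⁆

  size : ∣ D ∣ ≤ suc ∣ D - u ∣
  size = ≤-trans (p⊆q⇒∣p∣≤∣q∣ back)
    (≤-trans (∣p∪q∣≤∣p∣+∣q∣ ⁅ u ⁆ (D - u)) (≤-reflexive (cong (_+ ∣ D - u ∣) (∣⁅x⁆∣≡1 u))))
    where
    back : D ⊆ ⁅ u ⁆ ∪ (D - u)
    back {x} x∈D with x ≟ u
    ... | yes refl = x∈p∪q⁺ (inj₁ (x∈⁅x⁆ u))
    ... | no  x≢u  = x∈p∪q⁺ (inj₂ (x∈p∧x≢y⇒x∈p-y x∈D x≢u))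

-- Unlike glue, this notion is symmetric in the two graphs.
record OnePointUnion (G₁ : Graph m) (G₂ : Graph n) (H : Graph k)
                     (y₁ : Fin m) (x₂ : Fin n) : Set where
  field
    f         : Fin m → Fin k
    g         : Fin n → Fin k
    f-inj     : ∀ {i i′} → f i ≡ f i′ → i ≡ i′
    g-inj     : ∀ {j j′} → g j ≡ g j′ → j ≡ j′
    meet      : ∀ {i j} → f i ≡ g j → i ≡ y₁ × j ≡ x₂
    f-adj     : ∀ {i i′} → Adj G₁ i i′ → Adj H (f i) (f i′)
    g-adj     : ∀ {j j′} → Adj G₂ j j′ → Adj H (g j) (g j′)
    adj-split : ∀ {u v} → Adj H u v →
                (∃₂ λ i i′ → Adj G₁ i i′ × f i ≡ u × f i′ ≡ v) ⊎
                (∃₂ λ j j′ → Adj G₂ j j′ × g j ≡ u × g j′ ≡ v)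

  -- If the edge came from `G₂`, `meet` would place both of its ends at `x₂`, making it a loop.
  f-reflects : ∀ {i i′} → Adj H (f i) (f i′) → Adj G₁ i i′
  f-reflects fi~fi′ with adj-split fi~fi′
  ... | inj₁ (_ , _ , i~i′ , eq , eq′) = subst₂ (Adj G₁) (f-inj eq) (f-inj eq′) i~i′
  ... | inj₂ (_ , _ , j~j′ , eq , eq′) = contradiction j~j′
    (Adj-irrefl G₂ (trans (proj₂ (meet (sym eq))) (sym (proj₂ (meet (sym eq′))))))

-- Private neighbours in a one-point union and in its two parts.

module _ {G₁ : Graph m} {G₂ : Graph n} {H : Graph k} {y₁ : Fin m} {x₂ : Fin n}
         (O : OnePointUnion G₁ G₂ H y₁ x₂) where

  open OnePointUnion O

  swap : OnePointUnion G₂ G₁ H x₂ y₁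
  swap = record
    { f = g ; g = f ; f-inj = g-inj ; g-inj = f-inj
    ; meet = λ eq → let i≡y₁ , j≡x₂ = meet (sym eq) in j≡x₂ , i≡y₁
    ; f-adj = g-adj ; g-adj = f-adj ; adj-split = Sum.swap ∘ adj-split }

  module _ (D : Subset k) where

    -- Only the position of the private neighbour is tested; `f-reflects` then supplies the edge
    -- inside `G₁`.
    part? : Unary.Decidable (λ i → ∃ λ i′ → Private H D (f i′) (f i))
    part? i = any? λ i′ → private? H D (f i′) (f i)

    part : Subset m
    part = tabulate (does ∘ part?)

    part-matched : PrivatelyMatched G₁ part
    part-matched i∈ with i′ , π ← ∈-tabulate⁻ part? i∈ =
      i′ , mkPrivate i∈ (outer π ∘ part⇒D) (f-reflects (adjacent π))
        (λ i″ i″∈ i′~i″ → f-inj (unique π (f i″) (part⇒D i″∈) (f-adj i′~i″)))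
      where
      part⇒D : ∀ {i} → i ∈ part → f i ∈ D
      part⇒D i∈ = member (proj₂ (∈-tabulate⁻ part? i∈))

  module _ {D₁ : Subset m} {D₂ : Subset n} {D : Subset k}
           (y₁∉D₁ : y₁ ∉ D₁) (x₂∉D₂ : x₂ ∉ D₂)
           (into : ∀ {i} → i ∈ D₁ → f i ∈ D)
           (from : ∀ {v} → v ∈ D → (∃ λ i → i ∈ D₁ × f i ≡ v) ⊎ (∃ λ j → j ∈ D₂ × g j ≡ v))
    where

    -- A member of `D₂` mapped to `f i` would have to be `x₂`, which `D₂` avoids.
    from₁ : ∀ {i} → f i ∈ D → i ∈ D₁
    from₁ fi∈D with from fi∈D
    ... | inj₁ (_ , i∈D₁ , eq) = subst (_∈ D₁) (f-inj eq) i∈D₁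
    ... | inj₂ (_ , j∈D₂ , eq) =
      contradiction (subst (_∈ D₂) (proj₂ (meet (sym eq))) j∈D₂) x₂∉D₂

    from₂ : ∀ {j} → g j ∈ D → j ∈ D₂
    from₂ gj∈D with from gj∈D
    ... | inj₁ (_ , i∈D₁ , eq) =
      contradiction (subst (_∈ D₁) (proj₁ (meet eq)) i∈D₁) y₁∉D₁
    ... | inj₂ (_ , j∈D₂ , eq) = subst (_∈ D₂) (g-inj eq) j∈D₂

    -- A further neighbour of `f w` in `D` can only be reached along an edge of `G₂`. That forces
    -- `w ≡ y₁`, the case covered by the second hypothesis.
    Private-glue : ∀ {w u} → Private G₁ D₁ w u → (w ≡ y₁ → NoNeighbourIn G₂ D₂ x₂) →
                   Private H D (f w) (f u)
    Private-glue {w} {u} π isolated =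
      mkPrivate (into (member π)) (outer π ∘ from₁) (f-adj (adjacent π)) uniq
      where
      uniq : ∀ v → v ∈ D → Adj H (f w) v → v ≡ f u
      uniq v v∈D w~v with adj-split w~v
      ... | inj₁ (i , i′ , i~i′ , eq , refl) =
        cong f (unique π i′ (from₁ v∈D) (subst (λ z → Adj G₁ z i′) (f-inj eq) i~i′))
      ... | inj₂ (j , j′ , j~j′ , eq , refl) = contradiction
        (subst (λ z → Adj G₂ z j′) (proj₂ (meet (sym eq))) j~j′)
        (isolated (proj₁ (meet (sym eq))) j′ (from₂ v∈D))

-- Splitting and merging matched sets.

module _ {G₁ : Graph m} {G₂ : Graph n} {H : Graph k} {y₁ : Fin m} {x₂ : Fin n}
         (O : OnePointUnion G₁ G₂ H y₁ x₂) where

  open OnePointUnion O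

  -- The edge from a vertex of `D` to a private neighbour lies in one of the two graphs, which
  -- decides its part. The identified vertex may enter both parts; this can only enlarge the
  -- right-hand side.
  split-matched : (D : Subset k) → PrivatelyMatched H D →
    ∃₂ λ D₁ D₂ → PrivatelyMatched G₁ D₁ × PrivatelyMatched G₂ D₂ × ∣ D ∣ ≤ ∣ D₁ ∣ + ∣ D₂ ∣
  split-matched D matched = D₁ , D₂ , part-matched O D , part-matched (swap O) D ,
    (begin
      ∣ D ∣                           ≤⟨ p⊆q⇒∣p∣≤∣q∣ cover ⟩
      ∣ image f D₁ ∪ image g D₂ ∣     ≤⟨ ∣p∪q∣≤∣p∣+∣q∣ (image f D₁) (image g D₂) ⟩
      ∣ image f D₁ ∣ + ∣ image g D₂ ∣ ≤⟨ +-mono-≤ (∣image∣≤ f D₁) (∣image∣≤ g D₂) ⟩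
      ∣ D₁ ∣ + ∣ D₂ ∣                 ∎)
    where
    open ≤-Reasoning

    D₁ : Subset m
    D₁ = part O D

    D₂ : Subset n
    D₂ = part (swap O) D

    cover : D ⊆ image f D₁ ∪ image g D₂
    cover v∈D with w , π ← matched v∈D with adj-split (adjacent π)
    ... | inj₁ (i′ , i , _ , refl , refl) =
      x∈p∪q⁺ (inj₁ (∈-image⁺ f D₁ (∈-tabulate⁺ (part? O D) (i′ , π))))
    ... | inj₂ (j′ , j , _ , refl , refl) =
      x∈p∪q⁺ (inj₂ (∈-image⁺ g D₂ (∈-tabulate⁺ (part? (swap O) D) (j′ , π))))

  -- The images can meet only at the identified vertex, which both sets avoid, so no size is lost in
  -- the union.
  glue-matched : (D₁ : Subset m) (D₂ : Subset n) → y₁ ∉ D₁ → x₂ ∉ D₂ →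
    (∀ {u} → u ∈ D₁ → ∃ λ w → Private G₁ D₁ w u × (w ≡ y₁ → NoNeighbourIn G₂ D₂ x₂)) →
    (∀ {u} → u ∈ D₂ → ∃ λ w → Private G₂ D₂ w u × (w ≡ x₂ → NoNeighbourIn G₁ D₁ y₁)) →
    ∃ λ D → PrivatelyMatched H D × ∣ D₁ ∣ + ∣ D₂ ∣ ≤ ∣ D ∣
  glue-matched D₁ D₂ y₁∉D₁ x₂∉D₂ matched₁ matched₂ = D , matched ,
    ≤-trans (+-mono-≤ (∣image∣≥ f f-inj D₁) (∣image∣≥ g g-inj D₂))
            (disjoint⇒∣p∣+∣q∣≤∣p∪q∣ (image f D₁) (image g D₂) disjoint)
    where
    D : Subset k
    D = image f D₁ ∪ image g D₂

    disjoint : Empty (image f D₁ ∩ image g D₂)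
    disjoint (v , v∈) with x∈p∩q⁻ (image f D₁) (image g D₂) v∈
    ... | v∈f , v∈g with ∈-image⁻ f D₁ v∈f | ∈-image⁻ g D₂ v∈g
    ... | i , i∈D₁ , refl | j , j∈D₂ , eq with refl , refl ← meet (sym eq) = y₁∉D₁ i∈D₁

    into₁ : ∀ {i} → i ∈ D₁ → f i ∈ D
    into₁ i∈ = x∈p∪q⁺ (inj₁ (∈-image⁺ f D₁ i∈))

    into₂ : ∀ {j} → j ∈ D₂ → g j ∈ D
    into₂ j∈ = x∈p∪q⁺ (inj₂ (∈-image⁺ g D₂ j∈))

    from : ∀ {v} → v ∈ D → (∃ λ i → i ∈ D₁ × f i ≡ v) ⊎ (∃ λ j → j ∈ D₂ × g j ≡ v)
    from v∈ = Sum.map (∈-image⁻ f D₁) (∈-image⁻ g D₂) (x∈p∪q⁻ _ _ v∈)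

    matched : PrivatelyMatched H D
    matched v∈ with from v∈
    ... | inj₁ (_ , i∈ , refl) = let w , π , isolated = matched₁ i∈ in
      f w , Private-glue O y₁∉D₁ x₂∉D₂ into₁ from π isolated
    ... | inj₂ (_ , j∈ , refl) = let w , π , isolated = matched₂ j∈ in
      g w , Private-glue (swap O) x₂∉D₂ y₁∉D₁ into₂ (Sum.swap ∘ from) π isolated

  -- One deletion repairs both sides: once `y₁` has no neighbour in `D₁′`, it is private to nothing
  -- there, and `x₂` may stay a private neighbour for `D₂`. The second case is the mirror image; in
  -- the third nothing is deleted.
  merge-matched-avoiding : (D₁ : Subset m) (D₂ : Subset n) →
    PrivatelyMatched G₁ D₁ → PrivatelyMatched G₂ D₂ → y₁ ∉ D₁ → x₂ ∉ D₂ →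
    ∃ λ D → PrivatelyMatched H D × ∣ D₁ ∣ + ∣ D₂ ∣ ≤ suc ∣ D ∣
  merge-matched-avoiding D₁ D₂ matched₁ matched₂ y₁∉D₁ x₂∉D₂
    with isolateOrUnused G₁ y₁ D₁ matched₁ y₁∉D₁ | isolateOrUnused G₂ x₂ D₂ matched₂ x₂∉D₂
  ... | inj₁ (D₁′ , matched₁′ , y₁∉D₁′ , isolated , size) | _
    with D , matched , size′ ← glue-matched D₁′ D₂ y₁∉D₁′ x₂∉D₂
           (λ u∈ → let w , π = matched₁′ u∈ in
              w , π , λ { refl → contradiction (adjacent π) (isolated _ u∈) })
           (λ u∈ → let w , π = matched₂ u∈ in w , π , λ _ → isolated) =
    D , matched , ≤-trans (+-monoˡ-≤ ∣ D₂ ∣ size) (s≤s size′)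
  ... | inj₂ _ | inj₁ (D₂′ , matched₂′ , x₂∉D₂′ , isolated , size)
    with D , matched , size′ ← glue-matched D₁ D₂′ y₁∉D₁ x₂∉D₂′
           (λ u∈ → let w , π = matched₁ u∈ in w , π , λ _ → isolated)
           (λ u∈ → let w , π = matched₂′ u∈ in
              w , π , λ { refl → contradiction (adjacent π) (isolated _ u∈) }) =
    D , matched ,
    ≤-trans (+-monoʳ-≤ ∣ D₁ ∣ size) (≤-trans (≤-reflexive (+-suc _ _)) (s≤s size′))
  ... | inj₂ unused₁ | inj₂ unused₂
    with D , matched , size ← glue-matched D₁ D₂ y₁∉D₁ x₂∉D₂
           (λ u∈ → let w , π = matched₁ u∈ in
              w , π , λ w≡y₁ → contradiction w≡y₁ (unused₁ w _ π))
           (λ u∈ → let w , π = matched₂ u∈ in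
              w , π , λ w≡x₂ → contradiction w≡x₂ (unused₂ w _ π)) =
    D , matched , m≤n⇒m≤1+n size

  merge-matched : (D₁ : Subset m) (D₂ : Subset n) →
    PrivatelyMatched G₁ D₁ → PrivatelyMatched G₂ D₂ →
    ∃ λ D → PrivatelyMatched H D × ∣ D₁ ∣ + ∣ D₂ ∣ ≤ suc ∣ D ∣
  merge-matched D₁ D₂ matched₁ matched₂
    with D₁′ , matched₁′ , y₁∉ , size₁ ← matchedAvoiding G₁ y₁ D₁ matched₁
       | D₂′ , matched₂′ , x₂∉ , size₂ ← matchedAvoiding G₂ x₂ D₂ matched₂
    with D , matched , size ← merge-matched-avoiding D₁′ D₂′ matched₁′ matched₂′ y₁∉ x₂∉ =
    D , matched , ≤-trans (+-mono-≤ size₁ size₂) size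

  -- The two inequalities, by counting vertices.

  module _ (k+1≡m+n : suc k ≡ m + n) where

    open ≤-Reasoning

    -- Splitting loses no member of `D`, so the slack of one is exactly the vertex lost in the
    -- identification.
    γsp-union-lower : γsp G₁ + γsp G₂ ≤ suc (γsp H)
    γsp-union-lower
      with D , matched , eq ← maximumMatched H
      with D₁ , D₂ , matched₁ , matched₂ , size ← split-matched D matched =
      +-cancelʳ-≤ ∣ D ∣ _ _ (begin
        γsp G₁ + γsp G₂ + ∣ D ∣               ≤⟨ +-monoʳ-≤ (γsp G₁ + γsp G₂) size ⟩
        γsp G₁ + γsp G₂ + (∣ D₁ ∣ + ∣ D₂ ∣)   ≡⟨ interchange +-commutativeSemigroup (γsp G₁) (γsp G₂) ∣ D₁ ∣ ∣ D₂ ∣ ⟩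
        (γsp G₁ + ∣ D₁ ∣) + (γsp G₂ + ∣ D₂ ∣) ≤⟨ +-mono-≤ (γsp+∣matched∣≤n G₁ matched₁)
                                                          (γsp+∣matched∣≤n G₂ matched₂) ⟩
        m + n                                 ≡⟨ k+1≡m+n ⟨
        suc k                                 ≡⟨ cong suc eq ⟨
        suc (γsp H) + ∣ D ∣                   ∎)

    -- The vertex possibly deleted in merging is offset by the vertex lost in the identification.
    γsp-union-upper : γsp H ≤ γsp G₁ + γsp G₂
    γsp-union-upper
      with D₁ , matched₁ , eq₁ ← maximumMatched G₁ | D₂ , matched₂ , eq₂ ← maximumMatched G₂
      with D , matched , size ← merge-matched D₁ D₂ matched₁ matched₂ =
      +-cancelʳ-≤ (∣ D₁ ∣ + ∣ D₂ ∣) _ _ (begin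
        γsp H + (∣ D₁ ∣ + ∣ D₂ ∣)             ≤⟨ +-monoʳ-≤ (γsp H) size ⟩
        γsp H + suc ∣ D ∣                     ≡⟨ +-suc _ _ ⟩
        suc (γsp H + ∣ D ∣)                   ≤⟨ s≤s (γsp+∣matched∣≤n H matched) ⟩
        suc k                                 ≡⟨ k+1≡m+n ⟩
        m + n                                 ≡⟨ cong₂ _+_ eq₁ eq₂ ⟨
        (γsp G₁ + ∣ D₁ ∣) + (γsp G₂ + ∣ D₂ ∣) ≡⟨ interchange +-commutativeSemigroup (γsp G₁) (γsp G₂) ∣ D₁ ∣ ∣ D₂ ∣ ⟨
        γsp G₁ + γsp G₂ + (∣ D₁ ∣ + ∣ D₂ ∣)   ∎)

-- The chain as a one-point union.

chain-onePointUnion : (G₁ : Graph m) (G₂ : Graph n) (x₁ y₁ : Fin m) (x₂ y₂ : Fin n) →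
                      OnePointUnion G₁ G₂ (chain G₁ G₂ x₁ y₁ x₂ y₂) y₁ x₂
chain-onePointUnion G₁ G₂ x₁ y₁ x₂ y₂ = record
  { f         = glue y₁ x₂ ∘ inj₁
  ; g         = glue y₁ x₂ ∘ inj₂
  ; f-inj     = glue-injective₁ y₁ x₂
  ; g-inj     = glue-injective₂ y₁ x₂
  ; meet      = glue-identifies-only y₁ x₂
  ; f-adj     = λ i~i′ → _ , _ , inj₁ i~i′ , refl , refl
  ; g-adj     = λ j~j′ → _ , _ , inj₂ j~j′ , refl , refl
  ; adj-split = λ { (_ , _ , inj₁ i~i′ , eq , eq′) → inj₁ (_ , _ , i~i′ , eq , eq′)
                  ; (_ , _ , inj₂ j~j′ , eq , eq′) → inj₂ (_ , _ , j~j′ , eq , eq′) }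
  }

theorem3p2 : ∀ {n₁ n₂ : ℕ} (G₁ : Graph n₁) (G₂ : Graph n₂) →
    Connected G₁ → Connected G₂ →
    (x₁ y₁ : Fin n₁) (x₂ y₂ : Fin n₂) →
    (γsp G₁ + γsp G₂ ∸ 1 ≤ γsp (chain G₁ G₂ x₁ y₁ x₂ y₂)) ×
    (γsp (chain G₁ G₂ x₁ y₁ x₂ y₂) ≤ γsp G₁ + γsp G₂)
theorem3p2 {n₁} {suc n₂} G₁ G₂ _ _ x₁ y₁ x₂ y₂ =
  -- With the second order a successor, as `x₂` ensures, `pred` reduces and the chain has `n₁ + n₂`
  -- vertices, one fewer than the two graphs together.
  ∸-monoˡ-≤ 1 (γsp-union-lower O (sym (+-suc n₁ n₂))) , γsp-union-upper O (sym (+-suc n₁ n₂))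
  where
  O : OnePointUnion G₁ G₂ (chain G₁ G₂ x₁ y₁ x₂ y₂) y₁ x₂
  O = chain-onePointUnion G₁ G₂ x₁ y₁ x₂ y₂
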